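{- For every integer $d\ge 1$ there exists a (finite, simple, non-empty) $d$-regular graph $G$ whose weak degeneracy satisfies $\mathrm{wd}(G)=\lfloor d/2\rfloor+1$.
   Context: All graphs are finite and simple, with non-empty vertex set. A graph is $d$-regular if every vertex has degree $d$. $\mathbb{N}$ denotes the nonnegative integers. Operation $\mathrm{Delete}(G,f,u)$: given a graph $G$, a function $f:V(G)\to\mathbb{N}$ and a vertex $u\in V(G)$, it outputs the graph $G'=G-u$ and the function $f':V(G')\to\mathbb{Z}$ with $f'(v)=f(v)-1$ if $uv\in E(G)$ and $f'(v)=f(v)$ otherwise. It is legal if $f'$ is nonnegative. Operation $\mathrm{DeleteSave}(G,f,u,w)$: given a graph $G$, a function $f:V(G)\to\mathbb{N}$ and adjacent vertices $u,w\in V(G)$, it outputs $G'=G-u$ and $f':V(G')\to\mathbb{Z}$ with $f'(v)=f(v)-1$ if $uv\in E(G)$ and $v\ne w$, and $f'(v)=f(v)$ otherwise. It is legal if $f(u)>f(w)$ and $f'$ is nonnegative. $G$ is weakly $f$-degenerate if all vertices of $G$ can be removed by a sequence of legal applications of Delete and DeleteSave, starting from $(G,f)$, each operation being applied to the graph and function output by the previous one. For $k\in\mathbb{N}$, $G$ is weakly $k$-degenerate if it is weakly $f$-degenerate for the constant function $f\equiv k$. The weak degeneracy $\mathrm{wd}(G)$ is the minimum $k\in\mathbb{N}$ such that $G$ is weakly $k$-degenerate. -}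

module Defs where

open import Data.Bool using (if_then_else_)
open import Data.Fin using (Fin; punchIn)
open import Data.Fin.Properties using (_≟_)
open import Data.Fin.Subset using (Subset; ∣_∣)
open import Data.Integer as ℤ using (ℤ; +_; 0ℤ; 1ℤ)
open import Data.Nat using (ℕ; zero; suc; _<_; _≤_)
open import Data.Product using (_×_)
open import Data.Vec using (tabulate)
open import Level using (0ℓ)
open import Relation.Binary using (Rel; Decidable; Symmetric)
open import Relation.Binary.PropositionalEquality using (_≡_)
open import Relation.Nullary using (¬_; does; ¬?; _×-dec_)

-- The empty graph (n = 0) is allowed here because it is what remains after
-- the last vertex has been deleted.
record Graph (n : ℕ) : Set₁ where
  field
    Adj        : Rel (Fin n) 0ℓ
    adj?       : Decidable Adj
    Adj-sym    : Symmetric Adj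
    Adj-irrefl : ∀ v → ¬ Adj v v

open Graph public

neighbours : ∀ {n} → Graph n → Fin n → Subset n
neighbours G u = tabulate λ v → does (adj? G u v)

degree : ∀ {n} → Graph n → Fin n → ℕ
degree G u = ∣ neighbours G u ∣

Regular : ∀ {n} → ℕ → Graph n → Set
Regular d G = ∀ v → degree G v ≡ d

-- The vertices other than u are renumbered along the bijection
-- punchIn u : Fin n → Fin (suc n) ∖ {u}.
_-ᵥ_ : ∀ {n} → Graph (suc n) → Fin (suc n) → Graph n
G -ᵥ u = record
  { Adj        = λ v w → Adj G (punchIn u v) (punchIn u w)
  ; adj?       = λ v w → adj? G (punchIn u v) (punchIn u w)
  ; Adj-sym    = Adj-sym G
  ; Adj-irrefl = λ v → Adj-irrefl G (punchIn u v)
  }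

deleteFun : ∀ {n} → Graph (suc n) → (Fin (suc n) → ℕ) → Fin (suc n) → Fin n → ℤ
deleteFun G f u v′ =
  let v = punchIn u v′ in
  if does (adj? G u v) then + f v ℤ.- 1ℤ else + f v

deleteSaveFun : ∀ {n} → Graph (suc n) → (Fin (suc n) → ℕ) →
                Fin (suc n) → Fin (suc n) → Fin n → ℤ
deleteSaveFun G f u w v′ =
  let v = punchIn u v′ in
  if does (adj? G u v ×-dec ¬? (v ≟ w)) then + f v ℤ.- 1ℤ else + f v

Nonnegative : ∀ {n} → (Fin n → ℤ) → Set
Nonnegative f = ∀ v → 0ℤ ℤ.≤ f v

-- After a legal operation the new function is nonnegative, so taking absolute
-- values only turns its codomain from ℤ back into ℕ.
data WeaklyDegenerate : ∀ {n} → Graph n → (Fin n → ℕ) → Set₁ where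
  done : {G : Graph zero} {f : Fin zero → ℕ} → WeaklyDegenerate G f

  delete : ∀ {n} {G : Graph (suc n)} {f : Fin (suc n) → ℕ} (u : Fin (suc n)) →
           Nonnegative (deleteFun G f u) →
           WeaklyDegenerate (G -ᵥ u) (λ v → ℤ.∣ deleteFun G f u v ∣) →
           WeaklyDegenerate G f

  deleteSave : ∀ {n} {G : Graph (suc n)} {f : Fin (suc n) → ℕ} (u w : Fin (suc n)) →
               Adj G u w →
               f w < f u →
               Nonnegative (deleteSaveFun G f u w) →
               WeaklyDegenerate (G -ᵥ u) (λ v → ℤ.∣ deleteSaveFun G f u w v ∣) →
               WeaklyDegenerate G f

Weakly_-Degenerate : ∀ {n} → ℕ → Graph n → Set₁
Weakly k -Degenerate G = WeaklyDegenerate G (λ _ → k)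

-- wd(G) = k.
WeakDegeneracyIs : ∀ {n} → Graph n → ℕ → Set₁
WeakDegeneracyIs G k =
  Weakly k -Degenerate G × (∀ j → Weakly j -Degenerate G → k ≤ j)

{-# OPTIONS --safe #-}
module Submission where

-- Lower bound: deleting u lowers Σ f by at least its current degree (a
-- DeleteSave has f u ≥ 1, which pays for the saved unit), so |E| ≤ Σ f; the
-- first move on a constant f is a Delete, which makes the inequality strict.
--
-- Upper bound: the graph is invented while it is being dismantled.  A vertex is
-- recorded only by its remaining degree r and its value b of f, and deleting
-- (r , b) means choosing r of the remaining vertices as its neighbours.  It then
-- suffices to empty some multiset of copies of (d , ⌊ d / 2 ⌋ + 1).  Early deletions,
-- with high b, produce sinks (k , k) and many fuel vertices; the fuel is run
-- down by letting it save blocked vertices (e , 0), and its last part is spent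
-- on the sinks.

open import Algebra using (CommutativeMonoid)
open import Data.Bool using (Bool; true; false; T; if_then_else_; _∧_; not)
open import Data.Bool.Properties using (T?)
open import Data.Empty using (⊥)
open import Data.Fin using (Fin; zero; suc; punchIn)
open import Data.Fin.Properties using (_≟_; punchInᵢ≢i)
open import Data.Fin.Subset using (∣_∣)
open import Data.Integer as ℤ using (+_; 0ℤ; 1ℤ)
open import Data.List as List using (List; []; _∷_; [_]; _++_; map; length)
open import Data.List.Properties
  using (map-tabulate; map-++; map-∘; map-id; ++-assoc; ++-identityʳ; ∷-injective)
open import Data.List.Relation.Binary.Permutation.Propositional
  using (_↭_; ↭-sym; ↭-trans; ↭-refl; ↭-reflexive; prep; module PermutationReasoning)
open import Data.List.Relation.Binary.Permutation.Propositional.Properties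
  using (map⁺; ↭-map-inv; All-resp-↭; ↭-length; ++-commutativeMonoid; ++⁺; ++⁺ˡ; ++⁺ʳ; ++-comm)
open import Data.List.Relation.Unary.All as All using (All; []; _∷_)
import Data.List.Relation.Unary.All.Properties as All
open import Data.Nat using (ℕ; zero; suc; _≤_; _<_; _+_; _*_; z≤n; s≤s; z<s)
open import Data.Nat.DivMod using (_/_; _%_; m≡m%n+[m/n]*n; m%n<n; m<n*o⇒m/o<n)
open import Data.Nat.ListAction using () renaming (sum to listSum)
open import Data.Nat.ListAction.Properties using (sum-↭)
open import Data.Nat.Properties hiding (_≟_)
open import Data.Nat.Tactic.RingSolver using (solve-∀)
open import Data.Product using (Σ; ∃; _×_; _,_; proj₁; proj₂)
open import Data.Sum using (_⊎_; inj₁; inj₂)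
open import Data.Vec using (tabulate)
open import Function using (_∘_; mk⇔)
open import Relation.Binary.PropositionalEquality
  using (_≡_; refl; sym; trans; cong; cong₂; subst; subst₂; module ≡-Reasoning)
open import Relation.Nullary using (¬_; Dec; no; does; contradiction)
open import Relation.Nullary.Decidable using (does-⇔; dec-false; dec-true)
open import Algebra.Properties.CommutativeMonoid.Sum +-0-commutativeMonoid
  using (sum; sum-remove; sum-cong-≗; ∑-distrib-+; sum-replicate-zero)
open import Algebra.Properties.CommutativeMonoid.Mult (++-commutativeMonoid {A = ℕ × ℕ})
  using (×-homo-+; ×-assocˡ; ×-distrib-+; ×-congˡ) renaming (_×_ to _·_)
open import Algebra.Properties.CommutativeSemigroup
  (CommutativeMonoid.commutativeSemigroup (++-commutativeMonoid {A = ℕ × ℕ}))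
  using (interchange)
open import Defs

-- Finite sums and indicators.

𝟙 : Bool → ℕ
𝟙 b = if b then 1 else 0

∣tabulate∣ : ∀ {n} (p : Fin n → Bool) → ∣ tabulate p ∣ ≡ sum (𝟙 ∘ p)
∣tabulate∣ {zero}  p = refl
∣tabulate∣ {suc n} p with p zero
... | true  = cong suc (∣tabulate∣ (p ∘ suc))
... | false = ∣tabulate∣ (p ∘ suc)

sum-mono : ∀ {n} {f g : Fin n → ℕ} → (∀ i → f i ≤ g i) → sum f ≤ sum g
sum-mono {zero}  f≤g = z≤n
sum-mono {suc n} f≤g = +-mono-≤ (f≤g zero) (sum-mono (f≤g ∘ suc))

sum-const : ∀ n c → sum {n} (λ _ → c) ≡ n * c
sum-const zero    c = refl
sum-const (suc n) c = cong (_+_ c) (sum-const n c)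

sum-indicator : ∀ {n} (w : Fin n) → sum (λ v → 𝟙 (does (v ≟ w))) ≡ 1
sum-indicator {suc n} w = begin
  sum (λ v → 𝟙 (does (v ≟ w)))
    ≡⟨ sum-remove {i = w} (λ v → 𝟙 (does (v ≟ w))) ⟩
  𝟙 (does (w ≟ w)) + sum (λ v → 𝟙 (does (punchIn w v ≟ w)))
    ≡⟨ cong₂ _+_ (cong 𝟙 (dec-true (w ≟ w) refl))
                 (sum-cong-≗ λ v → cong 𝟙 (dec-false (punchIn w v ≟ w) (punchInᵢ≢i w v))) ⟩
  1 + sum {n} (λ _ → 0)
    ≡⟨ cong suc (sum-replicate-zero n) ⟩
  1 ∎
  where open ≡-Reasoning

-- Degree sums under the deletion of a vertex.

module _ {n} (G : Graph n) where

  adjacency : Fin n → Fin n → ℕ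
  adjacency u v = 𝟙 (does (adj? G u v))

  adjacency-sym : ∀ u v → adjacency u v ≡ adjacency v u
  adjacency-sym u v =
    cong 𝟙 (does-⇔ (mk⇔ (Adj-sym G) (Adj-sym G)) (adj? G u v) (adj? G v u))

  adjacency-irrefl : ∀ v → adjacency v v ≡ 0
  adjacency-irrefl v = cong 𝟙 (dec-false (adj? G v v) (Adj-irrefl G v))

  degree-sum : ∀ u → degree G u ≡ sum (adjacency u)
  degree-sum u = ∣tabulate∣ (λ v → does (adj? G u v))

  totalDegree : ℕ
  totalDegree = sum (degree G)

degree-punchIn : ∀ {n} (G : Graph (suc n)) u →
                 degree G u ≡ sum (λ v → adjacency G u (punchIn u v))
degree-punchIn G u = begin
  degree G u                                            ≡⟨ degree-sum G u ⟩
  sum (adjacency G u)                                   ≡⟨ sum-remove {i = u} (adjacency G u) ⟩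
  adjacency G u u + sum (λ v → adjacency G u (punchIn u v))
    ≡⟨ cong (_+ sum (λ v → adjacency G u (punchIn u v))) (adjacency-irrefl G u) ⟩
  sum (λ v → adjacency G u (punchIn u v))               ∎
  where open ≡-Reasoning

-- Each edge at `u` is counted twice, once at `u` and once at its other end.
totalDegree-delete : ∀ {n} (G : Graph (suc n)) u →
                     totalDegree G ≡ degree G u + degree G u + totalDegree (G -ᵥ u)
totalDegree-delete G u = begin
  sum (degree G)
    ≡⟨ sum-remove {i = u} (degree G) ⟩
  degree G u + sum (λ v → degree G (punchIn u v))
    ≡⟨ cong (_+_ (degree G u)) (sum-cong-≗ λ v → split (punchIn u v)) ⟩
  degree G u + sum (λ v → adjacency G u (punchIn u v) + sum (λ w → adjacency G (punchIn u v) (punchIn u w)))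
    ≡⟨ cong (_+_ (degree G u)) (∑-distrib-+ (λ v → adjacency G u (punchIn u v)) _) ⟩
  degree G u + (sum (λ v → adjacency G u (punchIn u v)) + sum (λ v → sum (λ w → adjacency G (punchIn u v) (punchIn u w))))
    ≡⟨ cong (_+_ (degree G u)) (cong₂ _+_ (sym (degree-punchIn G u))
         (sum-cong-≗ λ v → sym (degree-sum (G -ᵥ u) v))) ⟩
  degree G u + (degree G u + totalDegree (G -ᵥ u))
    ≡⟨ +-assoc (degree G u) _ _ ⟨
  degree G u + degree G u + totalDegree (G -ᵥ u) ∎
  where
  open ≡-Reasoning
  split : ∀ v → degree G v ≡ adjacency G u v + sum (λ w → adjacency G v (punchIn u w))
  split v = begin
    degree G v                                               ≡⟨ degree-sum G v ⟩
    sum (adjacency G v)                                      ≡⟨ sum-remove {i = u} (adjacency G v) ⟩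
    adjacency G v u + sum (λ w → adjacency G v (punchIn u w)) ≡⟨ cong (_+ sum (λ w → adjacency G v (punchIn u w))) (adjacency-sym G v u) ⟩
    adjacency G u v + sum (λ w → adjacency G v (punchIn u w)) ∎

-- Lower bound: the cost of a move in terms of the sum of `f`.

-- Nonnegativity rules out decrementing `m = 0`, the only case in which the absolute value would
-- spoil the count.
decrement : ∀ b m → 0ℤ ℤ.≤ (if b then + m ℤ.- 1ℤ else + m) →
            m ≡ ℤ.∣ (if b then + m ℤ.- 1ℤ else + m) ∣ + 𝟙 b
decrement true  (suc m) _ = sym (+-comm m 1)
decrement false m       _ = sym (+-identityʳ m)

delete-sum : ∀ {n} (G : Graph (suc n)) f u → Nonnegative (deleteFun G f u) →
             sum f ≡ f u + (sum (λ v → ℤ.∣ deleteFun G f u v ∣) + degree G u)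
delete-sum G f u f′≥0 = begin
  sum f                                  ≡⟨ sum-remove {i = u} f ⟩
  f u + sum (λ v → f (punchIn u v))      ≡⟨ cong (_+_ (f u)) (sum-cong-≗ λ v →
                                              decrement (does (adj? G u (punchIn u v))) _ (f′≥0 v)) ⟩
  f u + sum (λ v → ℤ.∣ deleteFun G f u v ∣ + adjacency G u (punchIn u v))
                                         ≡⟨ cong (_+_ (f u)) (∑-distrib-+ _ (λ v → adjacency G u (punchIn u v))) ⟩
  f u + (sum (λ v → ℤ.∣ deleteFun G f u v ∣) + sum (λ v → adjacency G u (punchIn u v)))
                                         ≡⟨ cong (λ x → f u + (sum (λ v → ℤ.∣ deleteFun G f u v ∣) + x)) (sym (degree-punchIn G u)) ⟩
  f u + (sum (λ v → ℤ.∣ deleteFun G f u v ∣) + degree G u) ∎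
  where open ≡-Reasoning

indicator-∧-not : ∀ a b → 𝟙 a ≤ 𝟙 (a ∧ not b) + 𝟙 b
indicator-∧-not true  true  = ≤-refl
indicator-∧-not true  false = ≤-refl
indicator-∧-not false b     = z≤n

deleteSave-sum : ∀ {n} (G : Graph (suc n)) f u w → f w < f u →
                 Nonnegative (deleteSaveFun G f u w) →
                 sum (λ v → ℤ.∣ deleteSaveFun G f u w v ∣) + degree G u ≤ sum f
deleteSave-sum G f u w fw<fu f′≥0 = begin
  sum f′ + degree G u
    ≡⟨ cong (_+_ (sum f′)) (degree-punchIn G u) ⟩
  sum f′ + sum (λ v → adjacency G u (punchIn u v))
    ≤⟨ +-monoʳ-≤ (sum f′) (sum-mono λ v →
         indicator-∧-not (does (adj? G u (punchIn u v))) (does (punchIn u v ≟ w))) ⟩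
  sum f′ + sum (λ v → hit v + saved v)
    ≡⟨ cong (_+_ (sum f′)) (∑-distrib-+ hit saved) ⟩
  sum f′ + (sum hit + sum saved)
    ≡⟨ +-assoc (sum f′) (sum hit) (sum saved) ⟨
  sum f′ + sum hit + sum saved
    ≡⟨ cong (_+ sum saved) (∑-distrib-+ f′ hit) ⟨
  sum (λ v → f′ v + hit v) + sum saved
    ≡⟨ cong (_+ sum saved) (sum-cong-≗ λ v → decrement _ (f (punchIn u v)) (f′≥0 v)) ⟨
  sum (λ v → f (punchIn u v)) + sum saved
    ≤⟨ +-monoʳ-≤ _ saved≤1 ⟩
  sum (λ v → f (punchIn u v)) + 1
    -- `f w < f u` forces `f u` to be positive, so the value that disappears with `u` pays for the
    -- saved unit.
    ≤⟨ +-monoʳ-≤ _ (≤-trans (s≤s z≤n) fw<fu) ⟩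
  sum (λ v → f (punchIn u v)) + f u
    ≡⟨ +-comm _ (f u) ⟩
  f u + sum (λ v → f (punchIn u v))
    ≡⟨ sum-remove {i = u} f ⟨
  sum f ∎
  where
  open ≤-Reasoning
  f′ = λ v → ℤ.∣ deleteSaveFun G f u w v ∣
  hit   = λ v → 𝟙 (does (adj? G u (punchIn u v)) ∧ not (does (punchIn u v ≟ w)))
  saved = λ v → 𝟙 (does (punchIn u v ≟ w))
  saved≤1 : sum saved ≤ 1
  -- Adding back the summand at `u` turns this into the indicator sum of `w` over all vertices.
  saved≤1 = ≤-trans (m≤n+m (sum saved) (𝟙 (does (u ≟ w))))
    (≤-reflexive (trans (sym (sum-remove {i = u} (λ v → 𝟙 (does (v ≟ w))))) (sum-indicator w)))

double : ∀ s d → d + d + 2 * s ≡ 2 * (s + d)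
double = solve-∀

-- Induction along the moves: each move lowers the sum of `f` by at least the number of edges it
-- removes. The factor 2 appears because `totalDegree` counts every edge at both ends.
totalDegree≤2sum : ∀ {n} {G : Graph n} {f} → WeaklyDegenerate G f → totalDegree G ≤ 2 * sum f
totalDegree≤2sum done = z≤n
totalDegree≤2sum {G = G} {f} (delete u f′≥0 wd) = begin
  totalDegree G                                     ≡⟨ totalDegree-delete G u ⟩
  degree G u + degree G u + totalDegree (G -ᵥ u)    ≤⟨ +-monoʳ-≤ (degree G u + degree G u) (totalDegree≤2sum wd) ⟩
  degree G u + degree G u + 2 * s                   ≡⟨ double s (degree G u) ⟩
  2 * (s + degree G u)                              ≤⟨ *-monoʳ-≤ 2 (m≤n+m (s + degree G u) (f u)) ⟩
  2 * (f u + (s + degree G u))                      ≡⟨ cong (2 *_) (delete-sum G f u f′≥0) ⟨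
  2 * sum f                                         ∎
  where
  open ≤-Reasoning
  s = sum (λ v → ℤ.∣ deleteFun G f u v ∣)
totalDegree≤2sum {G = G} {f} (deleteSave u w _ fw<fu f′≥0 wd) = begin
  totalDegree G                                     ≡⟨ totalDegree-delete G u ⟩
  degree G u + degree G u + totalDegree (G -ᵥ u)    ≤⟨ +-monoʳ-≤ (degree G u + degree G u) (totalDegree≤2sum wd) ⟩
  degree G u + degree G u + 2 * s                   ≡⟨ double s (degree G u) ⟩
  2 * (s + degree G u)                              ≤⟨ *-monoʳ-≤ 2 (deleteSave-sum G f u w fw<fu f′≥0) ⟩
  2 * sum f                                         ∎
  where
  open ≤-Reasoning
  s = sum (λ v → ℤ.∣ deleteSaveFun G f u w v ∣)

-- The first move cannot be a DeleteSave because f is constant, so it wastes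
-- the value j; this makes the bound strict when d is even.
regular-bound : ∀ {n} {G : Graph (suc n)} {d j} → 1 ≤ d → Regular d G →
                Weakly j -Degenerate G → d < 2 * j
regular-bound _ _ (deleteSave u w _ j<j _ _) = contradiction j<j (<-irrefl refl)
regular-bound {n} {G} {d} {j} 1≤d reg (delete u f′≥0 wd) =
  *-cancelˡ-< (suc n) d (2 * j) (begin-strict
    suc n * d            ≡⟨ total ⟨
    totalDegree G        <⟨ wasted j refl ⟩
    2 * (suc n * j)      ≡⟨ swap (suc n) j ⟩
    suc n * (2 * j)      ∎)
  where
  open ≤-Reasoning
  swap : ∀ a b → 2 * (a * b) ≡ a * (2 * b)
  swap = solve-∀
  s = sum (λ v → ℤ.∣ deleteFun G (λ _ → j) u v ∣)
  total : totalDegree G ≡ suc n * d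
  total = trans (sum-cong-≗ reg) (sum-const (suc n) d)
  slack : totalDegree G + 2 * j ≤ 2 * (suc n * j)
  slack = begin
    totalDegree G + 2 * j
      ≡⟨ cong (_+ 2 * j) (totalDegree-delete G u) ⟩
    degree G u + degree G u + totalDegree (G -ᵥ u) + 2 * j
      ≤⟨ +-monoˡ-≤ (2 * j) (+-monoʳ-≤ (degree G u + degree G u) (totalDegree≤2sum wd)) ⟩
    degree G u + degree G u + 2 * s + 2 * j
      ≡⟨ collect (degree G u) s j ⟩
    2 * (j + (s + degree G u))
      ≡⟨ cong (2 *_) (delete-sum G (λ _ → j) u f′≥0) ⟨
    2 * sum {suc n} (λ _ → j)
      ≡⟨ cong (2 *_) (sum-const (suc n) j) ⟩
    2 * (suc n * j) ∎
    where
    collect : ∀ d s j → d + d + 2 * s + 2 * j ≡ 2 * (j + (s + d))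
    collect = solve-∀
  wasted : ∀ i → i ≡ j → totalDegree G < 2 * (suc n * j)
  wasted (suc i) refl = ≤-trans (m<m+n (totalDegree G) z<s) slack
  -- For `j = 0` the first move wastes nothing, but then `slack` leaves no room for any edge,
  -- against `1 ≤ d`.
  wasted zero    refl = contradiction
    (begin-strict
      0                            <⟨ 1≤d ⟩
      d                            ≤⟨ m≤m+n d (n * d) ⟩
      suc n * d                    ≡⟨ total ⟨
      totalDegree G                ≤⟨ m≤m+n (totalDegree G) _ ⟩
      totalDegree G + 2 * 0        ≤⟨ slack ⟩
      2 * (suc n * 0)              ≡⟨ cong (2 *_) (*-zeroʳ (suc n)) ⟩
      0                            ∎)
    (<-irrefl refl)

lower-bound : ∀ {n} {G : Graph (suc n)} {d} → 1 ≤ d → Regular d G →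
              ∀ j → Weakly j -Degenerate G → d / 2 + 1 ≤ j
lower-bound {d = d} 1≤d reg j wd = subst (_≤ j) (+-comm 1 (d / 2))
  (m<n*o⇒m/o<n (subst (d <_) (*-comm 2 j) (regular-bound 1≤d reg wd)))

-- Building a graph backwards, one deletion at a time.

-- The new vertex is `zero`, so that `cone G p -ᵥ zero` is definitionally `G` and a removal sequence
-- for `G` can be continued from the cone without transport.
cone : ∀ {n} → Graph n → (Fin n → Bool) → Graph (suc n)
cone {n} G p = record { Adj = Adj′ ; adj? = adj?′ ; Adj-sym = λ {u} {v} → sym′ u v ; Adj-irrefl = irrefl′ }
  where
  Adj′ : Fin (suc n) → Fin (suc n) → Set
  Adj′ zero    zero    = ⊥
  Adj′ zero    (suc v) = T (p v)
  Adj′ (suc u) zero    = T (p u)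
  Adj′ (suc u) (suc v) = Adj G u v
  adj?′ : ∀ u v → Dec (Adj′ u v)
  adj?′ zero    zero    = no λ ()
  adj?′ zero    (suc v) = T? (p v)
  adj?′ (suc u) zero    = T? (p u)
  adj?′ (suc u) (suc v) = adj? G u v
  sym′ : ∀ u v → Adj′ u v → Adj′ v u
  sym′ zero    (suc v) a = a
  sym′ (suc u) zero    a = a
  sym′ (suc u) (suc v) a = Adj-sym G a
  irrefl′ : ∀ v → ¬ Adj′ v v
  irrefl′ (suc v) = Adj-irrefl G v

degree-cone-zero : ∀ {n} (G : Graph n) p → degree (cone G p) zero ≡ sum (𝟙 ∘ p)
degree-cone-zero G p = ∣tabulate∣ p

degree-cone-suc : ∀ {n} (G : Graph n) p v → degree (cone G p) (suc v) ≡ 𝟙 (p v) + degree G v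
degree-cone-suc G p v with p v
... | true  = refl
... | false = refl

-- The remaining degree of a vertex and its current value of f.
State : Set
State = ℕ × ℕ

-- What a deletion does to a remaining vertex; the argument is its state afterwards.
data Change : Set where
  keep hit save : State → Change

after before : Change → State
after (keep x) = x
after (hit x)  = x
after (save x) = x
before (keep x)       = x
before (hit (r , b))  = suc r , suc b
before (save (r , b)) = suc r , b

touched saved : Change → Bool
touched (keep _) = false
touched (hit _)  = true
touched (save _) = true
saved (keep _) = false
saved (hit _)  = false
saved (save _) = true

SavedBelow : ℕ → Change → Set
SavedBelow b c = T (saved c) → proj₂ (before c) < b

-- A list of states is read up to permutation: the vertices of graph are
-- numbered in the order in which they are deleted, whatever their order in xs.
record Realisable (xs : List State) : Set₁ where
  constructor realisation
  field
    {order}   : ℕ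
    state     : Fin order → State
    graph     : Graph order
    degrees   : ∀ v → degree graph v ≡ proj₁ (state v)
    removable : ∀ {f} → (∀ v → f v ≡ proj₂ (state v)) → WeaklyDegenerate graph f
    states    : List.tabulate state ↭ xs

0≤+ : ∀ {z m} → z ≡ + m → 0ℤ ℤ.≤ z
0≤+ refl = ℤ.+≤+ z≤n

deleted-value : ∀ c {x} → x ≡ proj₂ (before c) → saved c ≡ false →
                (if touched c then + x ℤ.- 1ℤ else + x) ≡ + proj₂ (after c)
deleted-value (keep _) refl _ = refl
deleted-value (hit _)  refl _ = refl

deleteSaved-value : ∀ c b {x} → x ≡ proj₂ (before c) → saved c ≡ b →
                    (if touched c ∧ not b then + x ℤ.- 1ℤ else + x) ≡ + proj₂ (after c)
deleteSaved-value (keep _) b    refl _    = refl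
deleteSaved-value (hit _)  _    refl refl = refl
deleteSaved-value (save _) _    refl refl = refl

∣+∣ : ∀ {z m} → z ≡ + m → ℤ.∣ z ∣ ≡ m
∣+∣ refl = refl

sum≡0 : ∀ {n} (p : Fin n → Bool) → sum (𝟙 ∘ p) ≡ 0 → ∀ v → p v ≡ false
sum≡0 p eq zero    with p zero
... | false = refl
sum≡0 p eq (suc v) with p zero
... | false = sum≡0 (p ∘ suc) eq v

-- Decides which operation a deletion uses: Delete if no vertex is saved, DeleteSave with target `w`
-- if exactly one is.
sum≤1 : ∀ {n} (p : Fin n → Bool) → sum (𝟙 ∘ p) ≤ 1 →
        (∀ v → p v ≡ false) ⊎ ∃ λ w → ∀ v → p v ≡ does (v ≟ w)
sum≤1 {zero}  p _ = inj₁ λ ()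
sum≤1 {suc n} p ≤1 with p zero in eq
... | true = inj₂ (zero , λ
  { zero    → eq
  ; (suc v) → sum≡0 (p ∘ suc) (n≤0⇒n≡0 (≤-pred ≤1)) v })
... | false with sum≤1 (p ∘ suc) ≤1
...   | inj₁ none       = inj₁ λ { zero → eq ; (suc v) → none v }
...   | inj₂ (w , only) = inj₂ (suc w , λ { zero → eq ; (suc v) → only v })

tabulate-map⁻ : ∀ {A B : Set} {g : A → B} {n} {s : Fin n → B} ys → List.tabulate s ≡ map g ys →
                ∃ λ u → List.tabulate u ≡ ys × ∀ v → s v ≡ g (u v)
tabulate-map⁻ {n = zero}  []       _  = (λ ()) , refl , λ ()
tabulate-map⁻ {n = suc n} (y ∷ ys) eq with ∷-injective eq
... | eq₀ , eqs with tabulate-map⁻ ys eqs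
...   | u , refl , s≗ = (λ { zero → y ; (suc v) → u v }) , refl , λ { zero → eq₀ ; (suc v) → s≗ v }

sum-listSum : ∀ {n} (t : Fin n → ℕ) → sum t ≡ listSum (List.tabulate t)
sum-listSum {zero}  t = refl
sum-listSum {suc n} t = cong (_+_ (t zero)) (sum-listSum (t ∘ suc))

-- The deleted vertex is coned over exactly the touched vertices and is removed first; the given
-- realisation removes the rest. At most one save and `SavedBelow` make this first move legal.
deletion : ∀ {b} us → listSum (map (𝟙 ∘ saved) us) ≤ 1 → All (SavedBelow b) us →
           Realisable (map after us) →
           Realisable ((listSum (map (𝟙 ∘ touched) us) , b) ∷ map before us)
deletion {b} us ≤1 below (realisation s G degs rem perm)
  -- The realisation numbers its vertices in its own order. Pulling the permutation back along
  -- `after` assigns a change `u v` to each vertex `v`.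
  with us′ , eq , us↭us′ ← ↭-map-inv after (↭-sym perm)
  with u , refl , s≗ ← tabulate-map⁻ us′ eq
  = realisation state′ G′ degs′ rem′ (prep _ perm′)
  where
  p = touched ∘ u
  G′ = cone G p
  count : ∀ (f : Change → Bool) → sum (𝟙 ∘ f ∘ u) ≡ listSum (map (𝟙 ∘ f) us)
  count f = trans (sum-listSum (𝟙 ∘ f ∘ u))
    (trans (cong listSum (sym (map-tabulate u (𝟙 ∘ f)))) (sym (sum-↭ (map⁺ (𝟙 ∘ f) us↭us′))))
  state′ : Fin _ → State
  state′ zero    = listSum (map (𝟙 ∘ touched) us) , b
  state′ (suc v) = before (u v)
  perm′ : List.tabulate (before ∘ u) ↭ map before us
  perm′ = ↭-trans (↭-reflexive (sym (map-tabulate u before))) (map⁺ before (↭-sym us↭us′))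
  degree-before : ∀ c → 𝟙 (touched c) + proj₁ (after c) ≡ proj₁ (before c)
  degree-before (keep _) = refl
  degree-before (hit _)  = refl
  degree-before (save _) = refl
  degs′ : ∀ v → degree G′ v ≡ proj₁ (state′ v)
  degs′ zero    = trans (degree-cone-zero G p) (count touched)
  degs′ (suc v) = trans (degree-cone-suc G p v)
    (trans (cong (_+_ (𝟙 (p v))) (trans (degs v) (cong proj₁ (s≗ v)))) (degree-before (u v)))
  saved⇒touched : ∀ c → T (saved c) → T (touched c)
  saved⇒touched (save _) _ = _
  -- All `f` with the right values are treated at once, because the function left by a move agrees
  -- with the recorded values only pointwise.
  rem′ : ∀ {f} → (∀ v → f v ≡ proj₂ (state′ v)) → WeaklyDegenerate G′ f
  rem′ {f} f≗ with sum≤1 (saved ∘ u) (subst (_≤ 1) (sym (count saved)) ≤1)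
  ... | inj₁ none = delete zero (λ v → 0≤+ (value v))
                      (rem λ v → trans (∣+∣ (value v)) (cong proj₂ (sym (s≗ v))))
    where
    value : ∀ v → deleteFun G′ f zero v ≡ + proj₂ (after (u v))
    value v = deleted-value (u v) (f≗ (suc v)) (none v)
  ... | inj₂ (w , only) = deleteSave zero (suc w)
                            (saved⇒touched (u w) w-saved)
                            (subst₂ _<_ (sym (f≗ (suc w))) (sym (f≗ zero))
                              (All.tabulate⁻ (All-resp-↭ us↭us′ below) w w-saved))
                            (λ v → 0≤+ (value v))
                            (rem λ v → trans (∣+∣ (value v)) (cong proj₂ (sym (s≗ v))))
    where
    value : ∀ v → deleteSaveFun G′ f zero (suc w) v ≡ + proj₂ (after (u v))
    value v = deleteSaved-value (u v) (does (v ≟ w)) (f≗ (suc v)) (only v)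
    w-saved : T (saved (u w))
    w-saved = subst T (sym (trans (only w) (dec-true (w ≟ w) refl))) _

-- Transitions between multisets of states.

infix 4 _⇝_

-- The quantification over zs makes a transition available inside a larger multiset.
record _⇝_ (xs ys : List State) : Set₁ where
  constructor play
  field realise : ∀ {zs} → Realisable (ys ++ zs) → Realisable (xs ++ zs)
open _⇝_

Realisable-resp-↭ : ∀ {xs ys} → xs ↭ ys → Realisable xs → Realisable ys
Realisable-resp-↭ p (realisation s G degs rem q) = realisation s G degs rem (↭-trans q p)

↭⇒⇝ : ∀ {xs ys} → xs ↭ ys → xs ⇝ ys
↭⇒⇝ p = play λ {zs} → Realisable-resp-↭ (++⁺ʳ zs (↭-sym p))

-- The arrow follows the deletions while realisations travel against it: the graph is built from the
-- last deletion to the first.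
⇝-trans : ∀ {xs ys zs} → xs ⇝ ys → ys ⇝ zs → xs ⇝ zs
⇝-trans p q = play (realise p ∘ realise q)

⇝-frame : ∀ {xs ys} zs → xs ⇝ ys → xs ++ zs ⇝ ys ++ zs
⇝-frame {xs} {ys} zs p = play λ {ws} →
  subst Realisable (sym (++-assoc xs zs ws)) ∘ realise p ∘ subst Realisable (++-assoc ys zs ws)

⇝-mono : ∀ {xs ys xs′ ys′} → xs ⇝ ys → xs′ ⇝ ys′ → xs ++ xs′ ⇝ ys ++ ys′
⇝-mono {xs} {ys} {xs′} {ys′} p q =
  ⇝-trans (⇝-frame xs′ p)
  (⇝-trans (↭⇒⇝ (++-comm ys xs′))
  (⇝-trans (⇝-frame ys q)
           (↭⇒⇝ (++-comm ys′ ys))))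

raise : State → State
raise (r , b) = suc r , suc b

module _ (ys zs : List State) where

  private
    hits : List Change
    hits = map hit ys ++ map keep zs

    touched-total : listSum (map (𝟙 ∘ touched) hits) ≡ length ys
    touched-total = go ys
      where
      go₀ : ∀ zs → listSum (map (𝟙 ∘ touched) (map keep zs)) ≡ 0
      go₀ []       = refl
      go₀ (_ ∷ zs) = go₀ zs
      go : ∀ ys → listSum (map (𝟙 ∘ touched) (map hit ys ++ map keep zs)) ≡ length ys
      go []       = go₀ zs
      go (_ ∷ ys) = cong suc (go ys)

    saved-total : listSum (map (𝟙 ∘ saved) hits) ≡ 0
    saved-total = go ys
      where
      go₀ : ∀ zs → listSum (map (𝟙 ∘ saved) (map keep zs)) ≡ 0
      go₀ []       = refl
      go₀ (_ ∷ zs) = go₀ zs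
      go : ∀ ys → listSum (map (𝟙 ∘ saved) (map hit ys ++ map keep zs)) ≡ 0
      go []       = go₀ zs
      go (_ ∷ ys) = go ys

    saved-below : ∀ {b} → All (SavedBelow b) hits
    saved-below = All.++⁺ (All.map⁺ (All.universal (λ _ ()) ys)) (All.map⁺ (All.universal (λ _ ()) zs))

    after-hits : map after hits ≡ ys ++ zs
    after-hits = trans (map-++ after (map hit ys) (map keep zs))
      (cong₂ _++_ (trans (sym (map-∘ ys)) (map-id ys)) (trans (sym (map-∘ zs)) (map-id zs)))

    before-hits : map before hits ≡ map raise ys ++ zs
    before-hits = trans (map-++ before (map hit ys) (map keep zs))
      (cong₂ _++_ (sym (map-∘ ys)) (trans (sym (map-∘ zs)) (map-id zs)))

  realise-delete : ∀ b → Realisable (ys ++ zs) →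
                   Realisable ((length ys , b) ∷ map raise ys ++ zs)
  realise-delete b real =
    subst₂ (λ r xs → Realisable ((r , b) ∷ xs)) touched-total before-hits
      (deletion hits (≤-trans (≤-reflexive saved-total) z≤n) saved-below
        (subst Realisable (sym after-hits) real))

  realise-deleteSave : ∀ {r g b} → g < b → Realisable ((r , g) ∷ ys ++ zs) →
                       Realisable ((suc (length ys) , b) ∷ (suc r , g) ∷ map raise ys ++ zs)
  realise-deleteSave {r} {g} {b} g<b real =
    subst₂ (λ s xs → Realisable ((suc s , b) ∷ (suc r , g) ∷ xs)) touched-total before-hits
      (deletion (save (r , g) ∷ hits) (≤-reflexive (cong suc saved-total)) ((λ _ → g<b) ∷ saved-below)
        (subst (λ xs → Realisable ((r , g) ∷ xs)) (sym after-hits) real))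

Realisable-[] : Realisable []
Realisable-[] = realisation (λ ())
  record { Adj = λ () ; adj? = λ () ; Adj-sym = λ {} ; Adj-irrefl = λ () }
  (λ ()) (λ _ → done) ↭-refl

-- Deletions along complete bipartite patterns.

length-copies : ∀ n (x : State) → length (n · [ x ]) ≡ n
length-copies zero    x = refl
length-copies (suc n) x = cong suc (length-copies n x)

map-copies : ∀ (g : State → State) n x → map g (n · [ x ]) ≡ n · [ g x ]
map-copies g zero    x = refl
map-copies g (suc n) x = cong (g x ∷_) (map-copies g n x)

copies-[] : ∀ n → n · [] ≡ []
copies-[] zero    = refl
copies-[] (suc n) = copies-[] n

⇝-delete : ∀ n b x → (n , b) ∷ n · [ raise x ] ⇝ n · [ x ]
⇝-delete n b x = play λ {zs} real →
  subst₂ (λ r xs → Realisable ((r , b) ∷ xs ++ zs)) (length-copies n x) (map-copies raise n x)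
    (realise-delete (n · [ x ]) zs b real)

⇝-deleteSave : ∀ n {b} r {g} x → g < b →
               (suc n , b) ∷ (suc r , g) ∷ n · [ raise x ] ⇝ (r , g) ∷ n · [ x ]
⇝-deleteSave n {b} r {g} x g<b = play λ {zs} real →
  subst₂ (λ m xs → Realisable ((suc m , b) ∷ (suc r , g) ∷ xs ++ zs))
    (length-copies n x) (map-copies raise n x)
    (realise-deleteSave (n · [ x ]) zs g<b real)

-- Each of the `p` vertices spends its `n` edges on all `n` targets, so every target is hit `p`
-- times. A plain Delete puts no condition on `b`.
biclique : ∀ p n {b r c} → p · [ (n , b) ] ++ n · [ (p + r , p + c) ] ⇝ n · [ (r , c) ]
biclique zero    n = ↭⇒⇝ ↭-refl
biclique (suc p) n {b} {r} {c} =
  ⇝-trans (↭⇒⇝ (prep _ (++-comm (p · [ (n , b) ]) (n · [ (suc p + r , suc p + c) ]))))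
  (⇝-trans (⇝-frame (p · [ (n , b) ]) (⇝-delete n b (p + r , p + c)))
  (⇝-trans (↭⇒⇝ (++-comm (n · [ (p + r , p + c) ]) (p · [ (n , b) ])))
           (biclique p n)))

-- All `p` deletions save the same vertex. Its value `g` never changes, so `g < b` stays available
-- for the next save.
saving-biclique : ∀ p n {b s g r c} → g < b →
  p · [ (suc n , b) ] ++ (p + s , g) ∷ n · [ (p + r , p + c) ] ⇝ (s , g) ∷ n · [ (r , c) ]
saving-biclique zero    n g<b = ↭⇒⇝ ↭-refl
saving-biclique (suc p) n {b} {s} {g} {r} {c} g<b =
  ⇝-trans (↭⇒⇝ (prep _ (++-comm P ((suc p + s , g) ∷ n · [ (suc p + r , suc p + c) ]))))
  (⇝-trans (⇝-frame P (⇝-deleteSave n (p + s) (p + r , p + c) g<b))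
  (⇝-trans (↭⇒⇝ (++-comm ((p + s , g) ∷ n · [ (p + r , p + c) ]) P))
           (saving-biclique p n g<b)))
  where P = p · [ (suc n , b) ]

-- ⇝* may use up any number of fresh vertices besides xs, which is harmless
-- because the order of the graph is free.
module WithSupply (fresh : State) where

  infix 4 _⇝*_

  _⇝*_ : List State → List State → Set₁
  xs ⇝* ys = ∃ λ n → n · [ fresh ] ++ xs ⇝ ys

  ⇝⇒⇝* : ∀ {xs ys} → xs ⇝ ys → xs ⇝* ys
  ⇝⇒⇝* p = 0 , p

  ↭⇒⇝* : ∀ {xs ys} → xs ↭ ys → xs ⇝* ys
  ↭⇒⇝* = ⇝⇒⇝* ∘ ↭⇒⇝

  ⇝*-trans : ∀ {xs ys zs} → xs ⇝* ys → ys ⇝* zs → xs ⇝* zs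
  ⇝*-trans {xs} {ys} {zs} (m , p) (n , q) = n + m ,
    ⇝-trans (↭⇒⇝ (↭-trans (++⁺ʳ xs (×-homo-+ [ fresh ] n m))
                          (↭-reflexive (++-assoc (n · [ fresh ]) (m · [ fresh ]) xs))))
    (⇝-trans (⇝-mono (↭⇒⇝ (↭-refl {x = n · [ fresh ]})) p) q)

  ⇝*-mono : ∀ {xs ys xs′ ys′} → xs ⇝* ys → xs′ ⇝* ys′ → xs ++ xs′ ⇝* ys ++ ys′
  ⇝*-mono {xs} {xs′ = xs′} (m , p) (n , q) = m + n ,
    ⇝-trans (↭⇒⇝ (↭-trans (++⁺ʳ (xs ++ xs′) (×-homo-+ [ fresh ] m n))
                          (interchange (m · [ fresh ]) (n · [ fresh ]) xs xs′)))
            (⇝-mono p q)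

  ⇝*-copies : ∀ n {xs ys} → xs ⇝* ys → n · xs ⇝* n · ys
  ⇝*-copies zero    p = ↭⇒⇝* ↭-refl
  ⇝*-copies (suc n) p = ⇝*-mono p (⇝*-copies n p)

-- The strategy for emptying a multiset of fresh vertices.

-- For h ∈ {0, 1} these are the degrees d = 2 e + h + 1, with k + 1 = ⌊ d / 2 ⌋ + 1.
-- A blocked vertex must be saved at each of its e remaining edges; a sink
-- needs no saving any more.
module Strategy (e h : ℕ) where

  k d : ℕ
  k = e + h
  d = suc (e + k)

  fresh fuel blocked sink : State
  fresh   = d , suc k
  fuel    = suc k , suc h
  blocked = e , 0
  sink    = k , k

  open WithSupply fresh

  -- Fuel is what a fresh vertex becomes after `e` hits.
  fresh→fuel : (e + suc k , e + suc h) ≡ fresh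
  fresh→fuel = cong₂ _,_ (+-suc e k) (+-suc e h)

  -- Each of `e` fresh vertices uses one edge to save the given vertex and `e + k` edges to hit one
  -- common set of fresh vertices. The saves bring the remaining degree down to the value `k`; the
  -- `e` hits make fuel.
  make-sink : [ (e + k , k) ] ⇝* [ sink ] ++ (e + k) · [ fuel ]
  make-sink = e + (e + k) ,
    ⇝-trans (↭⇒⇝ rearrange)
    (subst (λ x → e · [ fresh ] ++ (e + k , k) ∷ (e + k) · [ x ] ⇝ [ sink ] ++ (e + k) · [ fuel ])
           fresh→fuel
           (saving-biclique e (e + k) (n<1+n k)))
    where
    open PermutationReasoning
    rearrange : (e + (e + k)) · [ fresh ] ++ [ (e + k , k) ] ↭
                e · [ fresh ] ++ (e + k , k) ∷ (e + k) · [ fresh ]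
    rearrange = begin
      (e + (e + k)) · [ fresh ] ++ [ (e + k , k) ]
        ↭⟨ ++⁺ʳ _ (×-homo-+ [ fresh ] e (e + k)) ⟩
      (e · [ fresh ] ++ (e + k) · [ fresh ]) ++ [ (e + k , k) ]
        ≡⟨ ++-assoc (e · [ fresh ]) ((e + k) · [ fresh ]) _ ⟩
      e · [ fresh ] ++ (e + k) · [ fresh ] ++ [ (e + k , k) ]
        ↭⟨ ++⁺ˡ (e · [ fresh ]) (++-comm ((e + k) · [ fresh ]) _) ⟩
      e · [ fresh ] ++ (e + k , k) ∷ (e + k) · [ fresh ] ∎

  start : [ fresh ] ⇝* d · [ sink ] ++ (d * (e + k)) · [ fuel ]
  start =
    -- A single hit brings `d` fresh vertices to value `k`, just below the other fresh ones, which
    -- may then save them.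
    ⇝*-trans (d , ⇝-trans (↭⇒⇝ (++-comm (d · [ fresh ]) [ fresh ])) (⇝-delete d (suc k) (e + k , k)))
    (⇝*-trans (⇝*-copies d make-sink)
    (↭⇒⇝* (↭-trans (×-distrib-+ [ sink ] ((e + k) · [ fuel ]) d)
                   (++⁺ˡ (d · [ sink ]) (×-assocˡ [ fuel ] d (e + k))))))

  -- `suc h` hits exhaust the value of fuel and leave `suc k` minus `suc h`, that is `e`, edges.
  make-blocked : (suc h + suc k) · [ fuel ] ⇝* suc k · [ blocked ]
  make-blocked = ⇝*-trans (↭⇒⇝* (×-homo-+ [ fuel ] (suc h) (suc k)))
    (⇝⇒⇝* (subst (λ x → suc h · [ fuel ] ++ suc k · [ x ] ⇝ suc k · [ blocked ])
                 (cong₂ _,_ (cong suc (+-comm h e)) (+-identityʳ (suc h)))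
                 (biclique (suc h) (suc k))))

  discard : [ (0 , 0) ] ⇝* []
  discard = ⇝⇒⇝* (⇝-delete 0 0 (0 , 0))

  -- Each of `e` fuel vertices saves the blocked vertex once and hits the same `k` fresh vertices,
  -- which are fuel after `e` hits. The value `suc h` of fuel exceeds 0, so the saves are legal.
  refuel : e · [ fuel ] ++ [ blocked ] ⇝* k · [ fuel ]
  refuel = ⇝*-trans
    (k , ⇝-trans (↭⇒⇝ rearrange)
         (subst₂ (λ m x → e · [ fuel ] ++ (m , 0) ∷ k · [ x ] ⇝ (0 , 0) ∷ k · [ fuel ])
                 (+-identityʳ e) fresh→fuel
                 (saving-biclique e k z<s)))
    (⇝*-mono discard (↭⇒⇝* ↭-refl))
    where
    open PermutationReasoning
    rearrange : k · [ fresh ] ++ e · [ fuel ] ++ [ blocked ] ↭ e · [ fuel ] ++ blocked ∷ k · [ fresh ]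
    rearrange = begin
      k · [ fresh ] ++ e · [ fuel ] ++ [ blocked ]    ↭⟨ ++-comm (k · [ fresh ]) _ ⟩
      (e · [ fuel ] ++ [ blocked ]) ++ k · [ fresh ]  ≡⟨ ++-assoc (e · [ fuel ]) _ _ ⟩
      e · [ fuel ] ++ blocked ∷ k · [ fresh ]         ∎

  finish : k · [ fuel ] ++ suc k · [ sink ] ⇝* []
  finish = ⇝*-trans
    (⇝⇒⇝* (subst (λ m → k · [ fuel ] ++ suc k · [ (m , m) ] ⇝ suc k · [ (0 , 0) ])
                 (+-identityʳ k) (biclique k (suc k))))
    (⇝*-trans (⇝*-copies (suc k) discard) (↭⇒⇝* (↭-reflexive (copies-[] (suc k)))))

  -- The left side of `loss` is the fuel put into one round: what `make-blocked` takes plus `e` for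
  -- each of `suc k` refuels. The right side is the net loss `b` plus the fuel returned.
  module _ (b : ℕ) (loss : suc h + suc k + suc k * e ≡ b + suc k * k) where

    -- The decrease by b > 0 is what lets the fuel run down to the amount that
    -- the sinks can absorb.
    burn : (b + suc k * k) · [ fuel ] ⇝* (suc k * k) · [ fuel ]
    burn =
      ⇝*-trans (↭⇒⇝* (↭-trans (×-congˡ (sym loss)) (×-homo-+ [ fuel ] (suc h + suc k) (suc k * e))))
      (⇝*-trans (⇝*-mono make-blocked (↭⇒⇝* (↭-sym (×-assocˡ [ fuel ] (suc k) e))))
      (⇝*-trans (↭⇒⇝* (↭-trans (++-comm (suc k · [ blocked ]) (suc k · (e · [ fuel ])))
                               (↭-sym (×-distrib-+ (e · [ fuel ]) [ blocked ] (suc k)))))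
      (⇝*-trans (⇝*-copies (suc k) refuel)
                (↭⇒⇝* (×-assocˡ [ fuel ] (suc k) k)))))

    burn-many : ∀ t n → (t * b + (suc k * k + n)) · [ fuel ] ⇝* (suc k * k + n) · [ fuel ]
    burn-many zero    n = ↭⇒⇝* ↭-refl
    burn-many (suc t) n =
      ⇝*-trans (↭⇒⇝* (↭-trans (×-congˡ (regroup b (t * b) (suc k * k) n))
                              (×-homo-+ [ fuel ] (b + suc k * k) (t * b + n))))
      (⇝*-trans (⇝*-mono burn (↭⇒⇝* ↭-refl))
      (⇝*-trans (↭⇒⇝* (↭-trans (↭-sym (×-homo-+ [ fuel ] (suc k * k) (t * b + n)))
                               (×-congˡ (regroup′ (suc k * k) (t * b) n))))
                (burn-many t n)))
      where
      regroup : ∀ b s w n → b + s + (w + n) ≡ b + w + (s + n)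
      regroup = solve-∀
      regroup′ : ∀ w s n → w + (s + n) ≡ s + (w + n)
      regroup′ = solve-∀

  win : ∀ b → suc h + suc k + suc k * e ≡ suc b + suc k * k →
        (suc b * suc k) · [ fresh ] ⇝* []
  win b loss =
    ⇝*-trans (⇝*-copies c start)
    (⇝*-trans (↭⇒⇝* (↭-trans (×-distrib-+ (d · [ sink ]) ((d * (e + k)) · [ fuel ]) c)
                    (++⁺ (×-assocˡ [ sink ] c d) (×-assocˡ [ fuel ] c (d * (e + k))))))
    (⇝*-trans (⇝*-mono (↭⇒⇝* (↭-refl {x = (c * d) · [ sink ]}))
                (⇝*-trans (↭⇒⇝* (×-congˡ (fuel-count b e k)))
                -- The final amount of fuel is split as `suc k * k` plus a rest, so that a burn
                -- always has enough to run; the first number is the surplus divided by the loss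
                -- `suc b`.
                (⇝*-trans (burn-many (suc b) loss (d * (k * k + suc k * e)) (k * e + b * d * k))
                          (↭⇒⇝* (×-congˡ (final-count b e k))))))
    (⇝*-trans (↭⇒⇝* (↭-trans (++-comm ((c * d) · [ sink ]) ((suc b * d * k) · [ fuel ]))
                    (↭-trans (++⁺ (↭-sym (×-assocˡ [ fuel ] (suc b * d) k))
                                  (↭-trans (×-congˡ (sink-count b k d)) (↭-sym (×-assocˡ [ sink ] (suc b * d) (suc k)))))
                             (↭-sym (×-distrib-+ (k · [ fuel ]) (suc k · [ sink ]) (suc b * d))))))
    (⇝*-trans (⇝*-copies (suc b * d) finish) (↭⇒⇝* (↭-reflexive (copies-[] (suc b * d))))))))
    where
    -- The factor `suc k` lets the sinks be grouped for `finish`; the factor `suc b` makes the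
    -- surplus fuel a multiple of the loss of one burn.
    c = suc b * suc k
    fuel-count : ∀ b e k → suc b * suc k * (suc (e + k) * (e + k)) ≡
      suc (e + k) * (k * k + suc k * e) * suc b + (suc k * k + (k * e + b * suc (e + k) * k))
    fuel-count = solve-∀
    final-count : ∀ b e k → suc k * k + (k * e + b * suc (e + k) * k) ≡ suc b * suc (e + k) * k
    final-count = solve-∀
    sink-count : ∀ b k d → suc b * suc k * d ≡ suc b * d * suc k
    sink-count = solve-∀

-- From an emptied multiset to a regular graph, by parity of the degree.

Realised : ℕ → ℕ → Set₁
Realised d m = ∃ λ n → Σ (Graph (suc n)) λ G → Regular d G × Weakly m -Degenerate G

replicate-realised : ∀ {n d m} → 0 < n → Realisable (n · [ (d , m) ]) → Realised d m
replicate-realised {n} {d} {m} 0<n (realisation {suc o} s G degs rem perm) =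
  o , G , (λ v → trans (degs v) (cong proj₁ (s≗ v))) , rem (λ v → sym (cong proj₂ (s≗ v)))
  where
  all-copies : ∀ n → All (_≡ (d , m)) (n · [ (d , m) ])
  all-copies zero    = []
  all-copies (suc n) = refl ∷ all-copies n
  s≗ : ∀ v → s v ≡ (d , m)
  s≗ = All.tabulate⁻ (All-resp-↭ (↭-sym perm) (all-copies n))
replicate-realised {suc n} _ (realisation {zero} s G degs rem perm) with () ← ↭-length perm

-- The supply has the same state as the starting vertices, so the whole initial multiset is
-- constant: the graph is regular and `f` is constant.
win⇒realised : ∀ {d m} c → (let open WithSupply (d , m)) → suc c · [ (d , m) ] ⇝* [] → Realised d m
win⇒realised {d} {m} c (n , p) = replicate-realised (≤-trans (s≤s z≤n) (m≤n+m (suc c) n))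
  (Realisable-resp-↭ (↭-trans (↭-reflexive (++-identityʳ _)) (↭-sym (×-homo-+ [ (d , m) ] n (suc c))))
    (realise p Realisable-[]))

realised : ∀ e h b → suc h + suc (e + h) + suc (e + h) * e ≡ suc b + suc (e + h) * (e + h) →
           Realised (suc (e + (e + h))) (suc (e + h))
-- The successor of this number is `suc b * suc k`, the number of starting vertices in `win`.
realised e h b loss = win⇒realised (e + h + b * suc (e + h)) (Strategy.win e h b loss)

upper-bound : ∀ d → 1 ≤ d → Realised d (d / 2 + 1)
upper-bound d 1≤d = go (d % 2) (d / 2) (m≡m%n+[m/n]*n d 2) (m%n<n d 2)
  where
  go : ∀ r q → d ≡ r + q * 2 → r < 2 → Realised d (q + 1)
  go 0 zero    eq _ with () ← subst (1 ≤_) eq 1≤d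
  -- Even degree takes `h = 1`, where a burn loses 2 fuel; odd degree takes `h = 0`, where it loses
  -- `e + 2`. The third argument of `realised` is one less than this loss.
  go 0 (suc e) eq _ = subst₂ Realised (trans (degree-eq e) (sym eq)) (budget-eq e) (realised e 1 1 (loss e))
    where
    degree-eq : ∀ e → suc (e + (e + 1)) ≡ suc e * 2
    degree-eq = solve-∀
    budget-eq : ∀ e → suc (e + 1) ≡ suc e + 1
    budget-eq = solve-∀
    loss : ∀ e → 2 + suc (e + 1) + suc (e + 1) * e ≡ 2 + suc (e + 1) * (e + 1)
    loss = solve-∀
  go 1 e eq _ = subst₂ Realised (trans (degree-eq e) (sym eq)) (budget-eq e) (realised e 0 (suc e) (loss e))
    where
    degree-eq : ∀ e → suc (e + (e + 0)) ≡ 1 + e * 2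
    degree-eq = solve-∀
    budget-eq : ∀ e → suc (e + 0) ≡ e + 1
    budget-eq = solve-∀
    loss : ∀ e → 1 + suc (e + 0) + suc (e + 0) * e ≡ suc (suc e) + suc (e + 0) * (e + 0)
    loss = solve-∀
  go (suc (suc _)) _ _ (s≤s (s≤s ()))

theorem1 : ∀ (d : ℕ) → 1 ≤ d →
    ∃ λ (n : ℕ) → Σ (Graph (suc n)) λ G →
    Regular d G × WeakDegeneracyIs G (d / 2 + 1)
theorem1 d 1≤d with n , G , reg , wd ← upper-bound d 1≤d =
  n , G , reg , wd , lower-bound 1≤d reg
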